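{- Let $(W,S)$ be a finite Coxeter system and $\theta:W\to W$ a group automorphism with $\theta^2=\mathrm{id}$ and $\theta(S)=S$. Any linear extension of $\mathrm{Wk}(\theta)$ is a shelling order for $\Delta_\theta$ (where each $w\in\mathfrak{I}(\theta)$ is identified with the facet $wC_\emptyset$). In particular, $\Delta_\theta$ is shellable.
   Context: $\mathfrak{I}(\theta)=\{w\in W\mid \theta(w)=w^{ -1}\}$. For $s\in S$, $\underline{s}$ is a formal symbol; the free monoid on these symbols acts on the right on $W$ by $w\underline{s}=ws$ if $\theta(s)ws=w$, and $w\underline{s}=\theta(s)ws$ otherwise, with $w\underline{s}_1\cdots\underline{s}_k=(\cdots(w\underline{s}_1)\cdots)\underline{s}_k$; $\underline{s}_1\cdots\underline{s}_k$ alone means $e\underline{s}_1\cdots\underline{s}_k$, $e$ the identity. These are exactly the elements of $\mathfrak{I}(\theta)$; $\rho(w)$ is the minimal such $k$ for $w$. The weak order $\mathrm{Wk}(\theta)$ on $\mathfrak{I}(\theta)$: $v\preceq w$ iff there exist $s_1,\dots,s_k\in S$ with $v\underline{s}_1\cdots\underline{s}_k=w$ and $\rho(v)=\rho(w)-k$. Let $G_\theta$ be the edge-labelled graph on vertex set $\mathfrak{I}(\theta)$ with an edge labelled $s$ between $v$ and $w$ whenever $v\underline{s}=w$. For $J\subseteq S$ and $w\in\mathfrak{I}(\theta)$, $wC_J$ is the connected component containing $w$ of the subgraph of $G_\theta$ keeping only edges with labels in $J$ (as a labelled graph). $P_\theta=\{wC_J\}$ ordered by reverse inclusion of labelled subgraphs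 is the face poset of a pure Boolean cell complex $\Delta_\theta$ of dimension $|S|-1$ (cells $wC_J$ of dimension $|S|-|J|-1$, with $G_\theta$ the empty cell); its facets are the $wC_\emptyset$, $w\in\mathfrak{I}(\theta)$, and cell $g$ is contained in cell $h$ iff $h$ is a labelled subgraph of $g$. A shelling order of a pure Boolean cell complex is an ordering $F_0,\dots,F_t$ of its facets such that $F_i\cap(\bigcup_{\alpha<i}F_\alpha)$ is pure of codimension $1$ in $F_i$ for every $i\in\{1,\dots,t\}$. -}

module Defs where

open import Level using (_⊔_)
open import Algebra.Bundles using (Group)
open import Data.Nat as ℕ using (ℕ; zero; suc)
open import Data.Fin as Fin using (Fin; toℕ)
open import Data.Fin.Subset using (Subset; _∈_; ∣_∣) renaming (⊥ to ∅)
open import Data.List using (List; []; _∷_; _++_; length)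
open import Data.Product using (Σ; ∃; ∃-syntax; _×_; _,_; proj₁; proj₂)
open import Data.Sum using (_⊎_)
open import Data.Integer as ℤ using (ℤ; +_)
open import Relation.Nullary using (¬_)
open import Relation.Binary.PropositionalEquality using (_≡_)

rep : ∀ {a} {A : Set a} → ℕ → List A → List A
rep zero    u = []
rep (suc m) u = u ++ rep m u

-- Coxeter systems.  S is given as an injective family s : Fin n → W.
-- (W,S) is a Coxeter system iff the elements of S are involutions
-- (order 2), generate W, and W is presented by the generators S and the
-- relators (st)^{m(s,t)}, m(s,t) the order of st.  We encode the
-- relators as all words (ij)^m, m ≥ 1, that evaluate to the identity in W
-- (these are exactly the multiples of the orders, which generate the same
-- congruence), and "presented" as: the kernel of word evaluation is the
-- congruence generated by the relators.

module Words {c ℓ} (G : Group c ℓ) {n : ℕ} (s : Fin n → Group.Carrier G) where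
  open Group G

  eval : List (Fin n) → Carrier
  eval []      = ε
  eval (i ∷ u) = s i ∙ eval u

  Relator : List (Fin n) → Set ℓ
  Relator r = Σ (Fin n) λ i → Σ (Fin n) λ j → Σ ℕ λ m →
              (r ≡ rep (suc m) (i ∷ j ∷ [])) × (eval r ≈ ε)

  data _~_ : List (Fin n) → List (Fin n) → Set ℓ where
    ~-rel   : ∀ u r v → Relator r → (u ++ (r ++ v)) ~ (u ++ v)
    ~-refl  : ∀ {u} → u ~ u
    ~-sym   : ∀ {u v} → u ~ v → v ~ u
    ~-trans : ∀ {u v w} → u ~ v → v ~ w → u ~ w

record IsCoxeterSystem {c ℓ} (G : Group c ℓ) {n : ℕ}
                       (s : Fin n → Group.Carrier G) : Set (c ⊔ ℓ) where
  open Group G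
  open Words G s
  field
    involution   : ∀ i → s i ∙ s i ≈ ε
    nontrivial   : ∀ i → ¬ (s i ≈ ε)
    distinct     : ∀ i j → s i ≈ s j → i ≡ j
    generates    : ∀ w → ∃ λ u → eval u ≈ w
    presentation : ∀ u v → eval u ≈ eval v → u ~ v

IsFinite : ∀ {c ℓ} → Group c ℓ → Set (c ⊔ ℓ)
IsFinite G = Σ ℕ λ k → Σ (Fin k → Carrier) λ e →
             (∀ w → ∃ λ i → e i ≈ w) × (∀ i j → e i ≈ e j → i ≡ j)
  where open Group G

record IsInvolutiveAutPreservingS {c ℓ} (G : Group c ℓ) {n : ℕ}
       (s : Fin n → Group.Carrier G) (θ : Group.Carrier G → Group.Carrier G)
       : Set (c ⊔ ℓ) where
  open Group G
  field
    θ-cong      : ∀ {x y} → x ≈ y → θ x ≈ θ y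
    θ-hom       : ∀ x y → θ (x ∙ y) ≈ θ x ∙ θ y
    θ-injective : ∀ x y → θ x ≈ θ y → x ≈ y
    θ-surjective : ∀ y → ∃ λ x → θ x ≈ y
    θ-involutive : ∀ x → θ (θ x) ≈ x
    θ-S⊆S       : ∀ i → ∃ λ j → θ (s i) ≈ s j
    θ-S⊇S       : ∀ j → ∃ λ i → θ (s i) ≈ s j

module Twisted {c ℓ} (G : Group c ℓ) {n : ℕ} (s : Fin n → Group.Carrier G)
               (θ : Group.Carrier G → Group.Carrier G) where
  open Group G

  TwInv : Carrier → Set ℓ
  TwInv w = θ w ≈ w ⁻¹

  Act : Carrier → Fin n → Carrier → Set ℓ
  Act w i v = (θ (s i) ∙ w ∙ s i ≈ w × v ≈ w ∙ s i)
            ⊎ (¬ (θ (s i) ∙ w ∙ s i ≈ w) × v ≈ θ (s i) ∙ w ∙ s i)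

  data Run : Carrier → List (Fin n) → Carrier → Set (c ⊔ ℓ) where
    run-[] : ∀ {w v} → w ≈ v → Run w [] v
    run-∷  : ∀ {w u v i l} → Act w i u → Run u l v → Run w (i ∷ l) v

  Rank : Carrier → ℕ → Set (c ⊔ ℓ)
  Rank w k = (∃ λ l → length l ≡ k × Run ε l w)
           × (∀ l → Run ε l w → k ℕ.≤ length l)

  _⪯_ : Carrier → Carrier → Set (c ⊔ ℓ)
  v ⪯ w = ∃ λ l → Run v l w × Σ ℕ λ kv → Σ ℕ λ kw →
          Rank v kv × Rank w kw × kv ℕ.+ length l ≡ kw

  Edge : Carrier → Fin n → Carrier → Set ℓ
  Edge x i y = TwInv x × TwInv y × Act x i y

  data Conn (J : Subset n) : Carrier → Carrier → Set (c ⊔ ℓ) where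
    here : ∀ {x y} → x ≈ y → Conn J x y
    fwd  : ∀ {x y z i} → i ∈ J → Edge x i y → Conn J y z → Conn J x z
    bwd  : ∀ {x y z i} → i ∈ J → Edge y i x → Conn J y z → Conn J x z

  -- a cell wC_J is represented by the pair (w , J)
  Cell : Set c
  Cell = Carrier × Subset n

  IsCell : Cell → Set ℓ
  IsCell (w , J) = TwInv w

  VertexOf : Cell → Carrier → Set (c ⊔ ℓ)
  VertexOf (w , J) v = Conn J w v

  EdgeOf : Cell → Carrier → Fin n → Carrier → Set (c ⊔ ℓ)
  EdgeOf (w , J) x i y = i ∈ J × Conn J w x × Conn J w y × Edge x i y

  Subgraph : Cell → Cell → Set (c ⊔ ℓ)
  Subgraph h g = (∀ v → VertexOf h v → VertexOf g v)
               × (∀ x i y → EdgeOf h x i y → EdgeOf g x i y)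

  -- cell g is contained in (is a face of) cell h iff h is a labelled
  -- subgraph of g
  _⊑_ : Cell → Cell → Set (c ⊔ ℓ)
  g ⊑ h = Subgraph h g

  dim : Cell → ℤ
  dim (w , J) = (+ n ℤ.- + ∣ J ∣) ℤ.- + 1

  facet : Carrier → Cell
  facet w = (w , ∅)

  IsFacetOrdering : (N : ℕ) → (Fin N → Carrier) → Set (c ⊔ ℓ)
  IsFacetOrdering N ord = (∀ a → TwInv (ord a))
                        × (∀ w → TwInv w → ∃ λ a → ord a ≈ w)
                        × (∀ a b → ord a ≈ ord b → a ≡ b)

  IsLinearExtension : (N : ℕ) → (Fin N → Carrier) → Set (c ⊔ ℓ)
  IsLinearExtension N ord = IsFacetOrdering N ord
                          × (∀ a b → ord a ⪯ ord b → a Fin.≤ b)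

  InIntersection : ∀ {N} → (Fin N → Carrier) → Fin N → Cell → Set (c ⊔ ℓ)
  InIntersection ord i g = IsCell g × g ⊑ facet (ord i)
                         × ∃ λ α → α Fin.< i × g ⊑ facet (ord α)

  MaximalIn : (Cell → Set (c ⊔ ℓ)) → Cell → Set (c ⊔ ℓ)
  MaximalIn K g = K g × (∀ h → K h → g ⊑ h → h ⊑ g)

  PureCodim1 : ∀ {N} → (Fin N → Carrier) → Fin N → Set (c ⊔ ℓ)
  PureCodim1 ord i = ∀ g → MaximalIn (InIntersection ord i) g →
                     dim g ≡ dim (facet (ord i)) ℤ.- + 1

  IsShellingOrder : (N : ℕ) → (Fin N → Carrier) → Set (c ⊔ ℓ)
  IsShellingOrder N ord = IsFacetOrdering N ord
                        × (∀ (i : Fin N) → 0 ℕ.< toℕ i → PureCodim1 ord i)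

  Shellable : Set (c ⊔ ℓ)
  Shellable = ∃ λ N → ∃ λ ord → IsShellingOrder N ord

{-# OPTIONS --safe #-}
module Submission where

-- The parity N(u, t) of the number of occurrences of a reflection t among the
-- suffix reflections of a word u depends only on the element of W that u
-- represents, since the suffix reflections of a relator (st)^m run twice
-- through one period.  This gives the exchange condition for arbitrary words.
-- Define y ≼ w to mean that every word of w has a subword representing y.
-- Exchange gives the lifting properties of ≼ on both sides, and these combine
-- to lifting properties for the twisted action w ↦ w s̲.
--
-- Lifting y ≼ w along a twisted word of w yields a twisted word of y which is
-- strictly shorter unless y = w; so the rank drops by one at each descent.
-- If x has no descents in J, lifting also gives x ≼ y for all y in xC_J.  By
-- antisymmetry x is the only such vertex, and descending from any y inside
-- xC_J ends at x; hence x is the weak-order minimum of xC_J.  So a facet x that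
-- meets an earlier facet in a cell wC_J has a descent j ∈ J, and the codimension
-- one face xC_{j} contains wC_J and lies in the intersection.

open import Defs
open import Level using (_⊔_)
open import Algebra.Bundles using (Group)
open import Data.Bool as Bool using (Bool; true; false; not; _xor_)
open import Data.Bool.Properties
  using (xor-assoc; xor-same; not-distribʳ-xor; ¬-not; not-¬)
open import Data.Nat using (ℕ; zero; suc; _+_; _≤_; _<_; z≤n; s≤s)
import Data.Nat.Properties as ℕ
import Data.Integer as ℤ
import Data.Integer.Properties as ℤ
open import Data.Fin as Fin using (Fin)
open import Data.Fin.Properties using (any?; ≤∧≢⇒<)
open import Data.Fin.Subset using (Subset; _∈_; ⁅_⁆) renaming (⊥ to ∅)
open import Data.Fin.Subset.Properties
  using (_∈?_; ∉⊥; x∈⁅x⁆; x∈⁅y⁆⇒x≡y; ∣⁅x⁆∣≡1; ∣⊥∣≡0; ⊆-antisym)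
open import Data.List
  using (List; []; _∷_; _++_; length; map; reverse; [_]; filter; allFin; lookup)
open import Data.List.Properties using (unfold-reverse; reverse-involutive; length-++)
open import Data.List.Membership.Propositional.Properties
  using (∈-filter⁺; ∈-filter⁻; ∈-allFin; ∈-lookup)
open import Data.List.Relation.Binary.Permutation.Propositional using (↭-sym; ↭⇒↭ₛ)
open import Data.List.Relation.Binary.Permutation.Propositional.Properties using (∈-resp-↭)
open import Data.List.Relation.Binary.Permutation.Setoid.Properties using (Unique-resp-↭)
open import Data.List.Relation.Binary.Pointwise using (Pointwise-≡⇒≡)
open import Data.List.Relation.Binary.Sublist.Heterogeneous.Properties using (toPointwise)
open import Data.List.Relation.Binary.Sublist.Propositional
  using (_⊆_; []; _∷_; _∷ʳ_; ⊆-refl; ⊆-trans; minimum)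
open import Data.List.Relation.Binary.Sublist.Propositional.Properties
  using (reverse⁺; length-mono-≤)
import Data.List.Relation.Unary.All as All
open import Data.List.Relation.Unary.AllPairs using (_∷_)
open import Data.List.Relation.Unary.Any using (index)
open import Data.List.Relation.Unary.Any.Properties using (lookup-index)
open import Data.List.Relation.Unary.Sorted.TotalOrder.Properties using (lookup-mono-≤)
open import Data.List.Relation.Unary.Unique.Propositional using (Unique)
open import Data.List.Relation.Unary.Unique.Propositional.Properties
  using (filter⁺; allFin⁺)
import Data.List.Sort as Sort
open import Data.Product using (∃; _×_; _,_; proj₁; proj₂)
open import Data.Sum using (_⊎_; inj₁; inj₂)
open import Function using (_∘_; mk⇔)
open import Relation.Binary using (Decidable; DecTotalOrder)
import Relation.Binary.Construct.On as On
open import Relation.Nullary using (¬_; Dec; yes; no; does; contradiction)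
open import Relation.Nullary.Decidable using (does-⇔; _×-dec_)
open import Relation.Binary.PropositionalEquality as ≡ using (_≡_)
open import Tactic.MonoidSolver using (solve)

-- Lists, sublists and sums modulo 2.

length-∷ʳ : ∀ {a} {A : Set a} (xs : List A) x → length (xs ++ [ x ]) ≡ suc (length xs)
length-∷ʳ xs x = ≡.trans (length-++ xs) (ℕ.+-comm (length xs) 1)

lookup-injective : ∀ {a} {A : Set a} {xs : List A} → Unique xs →
  ∀ i j → lookup xs i ≡ lookup xs j → i ≡ j
lookup-injective (_ ∷ _)    Fin.zero    Fin.zero    _  = ≡.refl
lookup-injective (x∉xs ∷ _) Fin.zero    (Fin.suc j) eq =
  contradiction eq (All.lookup x∉xs (∈-lookup j))
lookup-injective (x∉xs ∷ _) (Fin.suc i) Fin.zero    eq =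
  contradiction (≡.sym eq) (All.lookup x∉xs (∈-lookup i))
lookup-injective (_ ∷ xs!)  (Fin.suc i) (Fin.suc j) eq = ≡.cong Fin.suc (lookup-injective xs! i j eq)

⊆-∷ʳ⁻ : ∀ {a} {A : Set a} {x : A} {us} vs → us ⊆ vs ++ [ x ] →
  us ⊆ vs ⊎ ∃ λ us′ → us′ ⊆ vs × us ≡ us′ ++ [ x ]
⊆-∷ʳ⁻ []       (_ ∷ʳ p)       = inj₁ p
⊆-∷ʳ⁻ []       (≡.refl ∷ [])  = inj₂ ([] , [] , ≡.refl)
⊆-∷ʳ⁻ (y ∷ vs) (_ ∷ʳ p) with ⊆-∷ʳ⁻ vs p
... | inj₁ q              = inj₁ (y ∷ʳ q)
... | inj₂ (us′ , q , eq) = inj₂ (us′ , y ∷ʳ q , eq)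
⊆-∷ʳ⁻ (y ∷ vs) (≡.refl ∷ p) with ⊆-∷ʳ⁻ vs p
... | inj₁ q              = inj₁ (≡.refl ∷ q)
... | inj₂ (us′ , q , eq) = inj₂ (y ∷ us′ , ≡.refl ∷ q , ≡.cong (y ∷_) eq)

⨁ : ℕ → (ℕ → Bool) → Bool
⨁ zero    f = false
⨁ (suc q) f = f q xor ⨁ q f

⨁-+-periodic : ∀ f m → (∀ q → f (q + m) ≡ f q) → ∀ q → ⨁ (q + m) f ≡ ⨁ q f xor ⨁ m f
⨁-+-periodic f m per zero    = ≡.refl
⨁-+-periodic f m per (suc q) = ≡.trans
  (≡.cong₂ _xor_ (per q) (⨁-+-periodic f m per q))
  (≡.sym (xor-assoc (f q) (⨁ q f) (⨁ m f)))

-- The two periods have equal sums, which cancel modulo 2. This is why a relator, with twice as many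
-- letters as its exponent, contributes nothing to a parity.
⨁-two-periods : ∀ f m → (∀ q → f (q + m) ≡ f q) → ⨁ (m + m) f ≡ false
⨁-two-periods f m per = ≡.trans (⨁-+-periodic f m per m) (xor-same (⨁ m f))

module Coxeter {c ℓ} (G : Group c ℓ) {n : ℕ} (s : Fin n → Group.Carrier G)
  (coxeter : IsCoxeterSystem G s) (_≟_ : Decidable (Group._≈_ G)) where

  open Group G
  open Words G s
  open IsCoxeterSystem coxeter
  open import Algebra.Properties.Group G
  open import Algebra.Properties.Monoid.Mult monoid using (×-homo-+)
    renaming (_×_ to _⋆_)
  open import Relation.Binary.Reasoning.Setoid setoid

  -- Generators, words and inverses.

  cancel-sʳ : ∀ w i → (w ∙ s i) ∙ s i ≈ w
  cancel-sʳ w i = begin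
    (w ∙ s i) ∙ s i ≈⟨ assoc _ _ _ ⟩
    w ∙ (s i ∙ s i) ≈⟨ ∙-congˡ (involution i) ⟩
    w ∙ ε           ≈⟨ identityʳ w ⟩
    w               ∎

  cancel-sˡ : ∀ i w → s i ∙ (s i ∙ w) ≈ w
  cancel-sˡ i w = begin
    s i ∙ (s i ∙ w) ≈⟨ assoc _ _ _ ⟨
    (s i ∙ s i) ∙ w ≈⟨ ∙-congʳ (involution i) ⟩
    ε ∙ w           ≈⟨ identityˡ w ⟩
    w               ∎

  s⁻¹ : ∀ i → s i ⁻¹ ≈ s i
  s⁻¹ i = sym (inverseʳ-unique (s i) (s i) (involution i))

  eval-++ : ∀ u v → eval (u ++ v) ≈ eval u ∙ eval v
  eval-++ []      v = sym (identityˡ _)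
  eval-++ (i ∷ u) v = trans (∙-congˡ (eval-++ u v)) (sym (assoc _ _ _))

  eval-∷ʳ : ∀ u i → eval (u ++ [ i ]) ≈ eval u ∙ s i
  eval-∷ʳ u i = trans (eval-++ u [ i ]) (∙-congˡ (identityʳ (s i)))

  eval-reverse : ∀ u → eval (reverse u) ≈ eval u ⁻¹
  eval-reverse []      = sym ε⁻¹≈ε
  eval-reverse (i ∷ u) = begin
    eval (reverse (i ∷ u)) ≈⟨ reflexive (≡.cong eval (unfold-reverse i u)) ⟩
    eval (reverse u ++ [ i ]) ≈⟨ eval-∷ʳ (reverse u) i ⟩
    eval (reverse u) ∙ s i ≈⟨ ∙-cong (eval-reverse u) (sym (s⁻¹ i)) ⟩
    eval u ⁻¹ ∙ s i ⁻¹     ≈⟨ ⁻¹-anti-homo-∙ (s i) (eval u) ⟨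
    (s i ∙ eval u) ⁻¹      ∎

  -- Parity of suffix reflections.

  does-≟ : ∀ {w x y z} → (w ≈ x → y ≈ z) → (y ≈ z → w ≈ x) → does (w ≟ x) ≡ does (y ≟ z)
  does-≟ to from = does-⇔ (mk⇔ to from) (_ ≟ _) (_ ≟ _)

  -- For u = i₁ ⋯ iₖ, the parity of the number of a such that t is the
  -- reflection x⁻¹ s(iₐ) x, where x = s(iₐ₊₁) ⋯ s(iₖ).
  parity : List (Fin n) → Carrier → Bool
  parity []      t = false
  parity (i ∷ u) t = does ((s i ∙ eval u) ≟ (eval u ∙ t)) xor parity u t

  parity-congʳ : ∀ u {t t′} → t ≈ t′ → parity u t ≡ parity u t′
  parity-congʳ []      t≈t′ = ≡.refl
  parity-congʳ (i ∷ u) t≈t′ = ≡.cong₂ _xor_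
    (does-≟ (λ e → trans e (∙-congˡ t≈t′)) (λ e → trans e (∙-congˡ (sym t≈t′))))
    (parity-congʳ u t≈t′)

  -- The reflection attached to a letter of `u` depends on what follows that letter only through its
  -- value in the group.
  parity-++-cong : ∀ u {x y t} → eval x ≈ eval y → parity x t ≡ parity y t →
    parity (u ++ x) t ≡ parity (u ++ y) t
  parity-++-cong []      x≈y eq = eq
  parity-++-cong (i ∷ u) {x} {y} x≈y eq = ≡.cong₂ _xor_
    (does-≟ (λ e → trans (∙-congˡ (sym ux≈uy)) (trans e (∙-congʳ ux≈uy)))
            (λ e → trans (∙-congˡ ux≈uy) (trans e (∙-congʳ (sym ux≈uy)))))
    (parity-++-cong u x≈y eq)
    where
    ux≈uy : eval (u ++ x) ≈ eval (u ++ y)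
    ux≈uy = trans (eval-++ u x) (trans (∙-congˡ x≈y) (sym (eval-++ u y)))

  -- Suffix reflections of the dihedral words `(ij)^k`.

  module _ (i j : Fin n) where
    private
      a = s i
      b = s j
      p = a ∙ b

    ⋆-comm : ∀ k → p ∙ k ⋆ p ≈ k ⋆ p ∙ p
    ⋆-comm zero    = trans (identityʳ p) (sym (identityˡ p))
    ⋆-comm (suc k) = trans (∙-congˡ (⋆-comm k)) (sym (assoc _ _ _))

    pbp≈b : p ∙ (b ∙ p) ≈ b
    pbp≈b = begin
      (a ∙ b) ∙ (b ∙ (a ∙ b)) ≈⟨ assoc _ _ _ ⟩
      a ∙ (b ∙ (b ∙ (a ∙ b))) ≈⟨ ∙-congˡ (cancel-sˡ j _) ⟩
      a ∙ (a ∙ b)             ≈⟨ cancel-sˡ i b ⟩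
      b                       ∎

    -- Conjugation by `b` inverts `p`; in inverse-free form this is `pbp≈b`, applied `k` times.
    dihedral : ∀ k → k ⋆ p ∙ (b ∙ k ⋆ p) ≈ b
    dihedral zero    = trans (identityˡ _) (identityʳ b)
    dihedral (suc k) = begin
      (p ∙ k ⋆ p) ∙ (b ∙ (p ∙ k ⋆ p)) ≈⟨ ∙-congʳ (⋆-comm k) ⟩
      (k ⋆ p ∙ p) ∙ (b ∙ (p ∙ k ⋆ p)) ≈⟨ regroup (k ⋆ p) p b ⟩
      k ⋆ p ∙ ((p ∙ (b ∙ p)) ∙ k ⋆ p) ≈⟨ ∙-congˡ (∙-congʳ pbp≈b) ⟩
      k ⋆ p ∙ (b ∙ k ⋆ p)             ≈⟨ dihedral k ⟩
      b                               ∎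
      where
      regroup : ∀ x y z → (x ∙ y) ∙ (z ∙ (y ∙ x)) ≈ x ∙ ((y ∙ (z ∙ y)) ∙ x)
      regroup x y z = solve monoid

    eval-rep : ∀ k v → eval (rep k (i ∷ j ∷ []) ++ v) ≈ k ⋆ p ∙ eval v
    eval-rep zero    v = sym (identityˡ _)
    eval-rep (suc k) v = begin
      a ∙ (b ∙ eval (rep k (i ∷ j ∷ []) ++ v)) ≈⟨ ∙-congˡ (∙-congˡ (eval-rep k v)) ⟩
      a ∙ (b ∙ (k ⋆ p ∙ eval v))               ≈⟨ regroup a b (k ⋆ p) (eval v) ⟩
      (p ∙ k ⋆ p) ∙ eval v                     ∎
      where
      regroup : ∀ x y z w → x ∙ (y ∙ (z ∙ w)) ≈ ((x ∙ y) ∙ z) ∙ w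
      regroup x y z w = solve monoid

    does-≟-cancelˡ : ∀ x {y z y′ z′} → y ≈ x ∙ y′ → z ≈ x ∙ z′ → does (y ≟ z) ≡ does (y′ ≟ z′)
    does-≟-cancelˡ x y≈ z≈ = does-≟
      (λ e → ∙-cancelˡ x _ _ (trans (sym y≈) (trans e z≈)))
      (λ e → trans y≈ (trans (∙-congˡ e) (sym z≈)))

    module _ (v : List (Fin n)) (t : Carrier) where
      private V = eval v

      -- Tests whether `t` is the reflection `V⁻¹ b p^q V`. This is the suffix reflection of the
      -- letter in position `q`, counted from zero and from the right, of the alternating word in
      -- front of `v`. Since `q` enters only through `p^q`, a trivial power of `p` makes `hit`
      -- periodic.
      hit : ℕ → Bool
      hit q = does ((b ∙ (q ⋆ p ∙ V)) ≟ (V ∙ t))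

      hit-even : ∀ k {E} → E ≈ k ⋆ p ∙ V →
        does ((b ∙ E) ≟ (E ∙ t)) ≡ hit (k + k)
      hit-even k {E} E≈ = does-≟-cancelˡ (k ⋆ p) lhs (trans (∙-congʳ E≈) (assoc _ _ _))
        where
        regroup : ∀ x y z → (x ∙ (y ∙ x)) ∙ (x ∙ z) ≈ x ∙ (y ∙ ((x ∙ x) ∙ z))
        regroup x y z = solve monoid
        lhs : b ∙ E ≈ k ⋆ p ∙ (b ∙ ((k + k) ⋆ p ∙ V))
        lhs = begin
          b ∙ E                                   ≈⟨ ∙-cong (sym (dihedral k)) E≈ ⟩
          (k ⋆ p ∙ (b ∙ k ⋆ p)) ∙ (k ⋆ p ∙ V)     ≈⟨ regroup (k ⋆ p) b V ⟩
          k ⋆ p ∙ (b ∙ ((k ⋆ p ∙ k ⋆ p) ∙ V))     ≈⟨ ∙-congˡ (∙-congˡ (∙-congʳ (×-homo-+ p k k))) ⟨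
          k ⋆ p ∙ (b ∙ ((k + k) ⋆ p ∙ V))         ∎

      hit-odd : ∀ k {E} → E ≈ k ⋆ p ∙ V →
        does ((a ∙ (b ∙ E)) ≟ ((b ∙ E) ∙ t)) ≡ hit (suc (k + k))
      hit-odd k {E} E≈ = does-≟-cancelˡ (b ∙ k ⋆ p) lhs rhs
        where
        K = k ⋆ p
        regroup₁ : ∀ x y z w → x ∙ (y ∙ (z ∙ w)) ≈ ((x ∙ y) ∙ z) ∙ w
        regroup₁ x y z w = solve monoid
        regroup₂ : ∀ x y z w → (y ∙ (x ∙ (y ∙ x))) ∙ (x ∙ (z ∙ w)) ≈ (y ∙ x) ∙ (y ∙ ((x ∙ x) ∙ (z ∙ w)))
        regroup₂ x y z w = solve monoid
        lhs : a ∙ (b ∙ E) ≈ (b ∙ K) ∙ (b ∙ ((suc (k + k)) ⋆ p ∙ V))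
        lhs = begin
          a ∙ (b ∙ E)                                ≈⟨ ∙-congˡ (∙-congˡ E≈) ⟩
          a ∙ (b ∙ (K ∙ V))                          ≈⟨ regroup₁ a b K V ⟩
          (p ∙ K) ∙ V                                ≈⟨ ∙-congʳ (⋆-comm k) ⟩
          (K ∙ p) ∙ V                                ≈⟨ assoc _ _ _ ⟩
          -- The identity inserted here is the square of `b ∙ K`, so that a factor `b ∙ K` can be
          -- split off on the left and cancelled.
          K ∙ (p ∙ V)                                ≈⟨ identityˡ _ ⟨
          ε ∙ (K ∙ (p ∙ V))                          ≈⟨ ∙-congʳ (trans (∙-congˡ (dihedral k)) (involution j)) ⟨
          (b ∙ (K ∙ (b ∙ K))) ∙ (K ∙ (p ∙ V))        ≈⟨ regroup₂ K b p V ⟩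
          (b ∙ K) ∙ (b ∙ ((K ∙ K) ∙ (p ∙ V)))        ≈⟨ ∙-congˡ (∙-congˡ (∙-congʳ (×-homo-+ p k k))) ⟨
          (b ∙ K) ∙ (b ∙ ((k + k) ⋆ p ∙ (p ∙ V)))    ≈⟨ ∙-congˡ (∙-congˡ (assoc _ _ _)) ⟨
          (b ∙ K) ∙ (b ∙ (((k + k) ⋆ p ∙ p) ∙ V))    ≈⟨ ∙-congˡ (∙-congˡ (∙-congʳ (⋆-comm (k + k)))) ⟨
          (b ∙ K) ∙ (b ∙ ((suc (k + k)) ⋆ p ∙ V))    ∎
        rhs : (b ∙ E) ∙ t ≈ (b ∙ K) ∙ (V ∙ t)
        rhs = begin
          (b ∙ E) ∙ t       ≈⟨ ∙-congʳ (∙-congˡ E≈) ⟩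
          (b ∙ (K ∙ V)) ∙ t ≈⟨ ∙-congʳ (assoc _ _ _) ⟨
          ((b ∙ K) ∙ V) ∙ t ≈⟨ assoc _ _ _ ⟩
          (b ∙ K) ∙ (V ∙ t) ∎

      parity-rep : ∀ k → parity (rep k (i ∷ j ∷ []) ++ v) t ≡ ⨁ (k + k) hit xor parity v t
      parity-rep zero = ≡.refl
      parity-rep (suc k) rewrite ℕ.+-suc k k = ≡.trans
        (≡.cong₂ _xor_ (hit-odd k (eval-rep k v))
          (≡.cong₂ _xor_ (hit-even k (eval-rep k v)) (parity-rep k)))
        (≡.sym (≡.trans (xor-assoc (hit (suc (k + k))) _ _)
          (≡.cong (hit (suc (k + k)) xor_) (xor-assoc (hit (k + k)) _ _))))

      hit-periodic : ∀ m → m ⋆ p ≈ ε → ∀ q → hit (q + m) ≡ hit q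
      hit-periodic m pᵐ≈ε q = does-≟
        (trans (∙-congˡ (∙-congʳ (sym q+m)))) (trans (∙-congˡ (∙-congʳ q+m)))
        where
        q+m : (q + m) ⋆ p ≈ q ⋆ p
        q+m = trans (×-homo-+ p q m) (trans (∙-congˡ pᵐ≈ε) (identityʳ _))

  parity-relator : ∀ {r} → Relator r → ∀ v t → parity (r ++ v) t ≡ parity v t
  parity-relator (i , j , m , ≡.refl , r≈ε) v t = ≡.trans (parity-rep i j v t (suc m))
    (≡.cong (_xor parity v t) (⨁-two-periods (hit i j v t) (suc m) (hit-periodic i j v t (suc m) pᵐ≈ε)))
    where
    r = rep (suc m) (i ∷ j ∷ [])
    pᵐ≈ε : suc m ⋆ (s i ∙ s j) ≈ ε
    pᵐ≈ε = begin
      suc m ⋆ (s i ∙ s j)     ≈⟨ identityʳ _ ⟨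
      suc m ⋆ (s i ∙ s j) ∙ ε ≈⟨ eval-rep i j (suc m) [] ⟨
      eval (r ++ [])          ≈⟨ eval-++ r [] ⟩
      eval r ∙ ε              ≈⟨ identityʳ _ ⟩
      eval r                  ≈⟨ r≈ε ⟩
      ε                       ∎

  -- Invariance of the parity and the exchange condition.

  parity-~ : ∀ {u v} t → u ~ v → parity u t ≡ parity v t
  parity-~ t (~-rel u r v rel@(_ , _ , _ , _ , r≈ε)) = parity-++-cong u
    (trans (eval-++ r v) (trans (∙-congʳ r≈ε) (identityˡ _)))
    (parity-relator rel v t)
  parity-~ t ~-refl        = ≡.refl
  parity-~ t (~-sym p)     = ≡.sym (parity-~ t p)
  parity-~ t (~-trans p q) = ≡.trans (parity-~ t p) (parity-~ t q)

  -- Appending `i` conjugates the old suffix reflections by `s i`, which fixes `s i` itself, and the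
  -- new last letter adds one more occurrence of `s i`.
  parity-∷ʳ : ∀ u i → parity (u ++ [ i ]) (s i) ≡ not (parity u (s i))
  parity-∷ʳ [] i with (s i ∙ ε) ≟ (ε ∙ s i)
  ... | yes _ = ≡.refl
  ... | no ¬e = contradiction (trans (identityʳ _) (sym (identityˡ _))) ¬e
  parity-∷ʳ (k ∷ u) i = ≡.trans
    (≡.cong₂ _xor_
      (does-≟
        (λ e → ∙-cancelʳ (s i) _ _
          (trans (assoc _ _ _) (trans (∙-congˡ (sym u∷ʳi)) (trans e (∙-congʳ u∷ʳi)))))
        (λ e → trans (∙-congˡ u∷ʳi)
          (trans (sym (assoc _ _ _)) (trans (∙-congʳ e) (∙-congʳ (sym u∷ʳi))))))
      (parity-∷ʳ u i))
    (≡.sym (not-distribʳ-xor (does ((s k ∙ eval u) ≟ (eval u ∙ s i))) (parity u (s i))))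
    where
    u∷ʳi = eval-∷ʳ u i

  -- An odd count is nonzero, so `t` is the reflection of some letter; deleting that letter
  -- multiplies the word by `t` on the right. This is the exchange condition for words that may be
  -- non-reduced.
  parity-deletion : ∀ u {t} → t ∙ t ≈ ε → parity u t ≡ true →
    ∃ λ u′ → u′ ⊆ u × eval u′ ≈ eval u ∙ t
  parity-deletion (i ∷ u) {t} t²≈ε odd with (s i ∙ eval u) ≟ (eval u ∙ t)
  ... | yes e = u , i ∷ʳ ⊆-refl , (begin
    eval u                 ≈⟨ identityʳ _ ⟨
    eval u ∙ ε             ≈⟨ ∙-congˡ t²≈ε ⟨
    eval u ∙ (t ∙ t)       ≈⟨ assoc _ _ _ ⟨
    (eval u ∙ t) ∙ t       ≈⟨ ∙-congʳ e ⟨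
    (s i ∙ eval u) ∙ t     ∎)
  ... | no _ with parity-deletion u t²≈ε odd
  ...   | u′ , u′⊆u , eq = i ∷ u′ , ≡.refl ∷ u′⊆u , trans (∙-congˡ eq) (sym (assoc _ _ _))

  -- Inversions and the Bruhat order.

  word : Carrier → List (Fin n)
  word w = proj₁ (generates w)

  eval-word : ∀ w → eval (word w) ≈ w
  eval-word w = proj₂ (generates w)

  -- For a reflection t, inverts w t holds iff w t is shorter than w.
  inverts : Carrier → Carrier → Bool
  inverts w t = parity (word w) t

  -- By `presentation`, words of the same element are linked by relators, which preserve the parity.
  -- So inversions may be computed from whichever word is convenient.
  parity-eval : ∀ u {w} t → eval u ≈ w → parity u t ≡ inverts w t
  parity-eval u {w} t u≈w =
    parity-~ t (presentation u (word w) (trans u≈w (sym (eval-word w))))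

  inverts-cong : ∀ {w w′ t t′} → w ≈ w′ → t ≈ t′ → inverts w t ≡ inverts w′ t′
  inverts-cong {w} {t′ = t′} w≈w′ t≈t′ = ≡.trans (parity-congʳ (word w) t≈t′)
    (parity-eval (word w) t′ (trans (eval-word w) w≈w′))

  inverts-∙s : ∀ w i → inverts (w ∙ s i) (s i) ≡ not (inverts w (s i))
  inverts-∙s w i = ≡.trans
    (≡.sym (parity-eval (word w ++ [ i ]) (s i) (trans (eval-∷ʳ (word w) i) (∙-congʳ (eval-word w)))))
    (parity-∷ʳ (word w) i)

  -- The Bruhat order in the form of the subword property.  Quantifying over
  -- all words of w, reduced or not, makes transitivity and lifting immediate.
  _≼_ : Carrier → Carrier → Set ℓ
  y ≼ w = ∀ u → eval u ≈ w → ∃ λ u′ → u′ ⊆ u × eval u′ ≈ y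

  ≼-refl : ∀ {w} → w ≼ w
  ≼-refl u u≈w = u , ⊆-refl , u≈w

  ≼-trans : ∀ {x y z} → x ≼ y → y ≼ z → x ≼ z
  ≼-trans x≼y y≼z u u≈z with y≼z u u≈z
  ... | u′ , u′⊆u , u′≈y with x≼y u′ u′≈y
  ...   | u″ , u″⊆u′ , u″≈x = u″ , ⊆-trans u″⊆u′ u′⊆u , u″≈x

  ≼-respˡ : ∀ {x y z} → x ≈ y → x ≼ z → y ≼ z
  ≼-respˡ x≈y x≼z u u≈z with x≼z u u≈z
  ... | u′ , u′⊆u , u′≈x = u′ , u′⊆u , trans u′≈x x≈y

  ≼-respʳ : ∀ {x y z} → x ≈ y → z ≼ x → z ≼ y
  ≼-respʳ x≈y z≼x u u≈y = z≼x u (trans u≈y (sym x≈y))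

  -- A subword of full length is the whole word. The strict alternative serves as a termination
  -- measure.
  ≼-subword : ∀ {y w} → y ≼ w → ∀ u → eval u ≈ w →
    y ≈ w ⊎ ∃ λ u′ → length u′ < length u × eval u′ ≈ y
  ≼-subword y≼w u u≈w with y≼w u u≈w
  ... | u′ , u′⊆u , u′≈y with length u′ ℕ.≟ length u
  ...   | yes eq = inj₁ (trans (sym u′≈y)
            (trans (reflexive (≡.cong eval (Pointwise-≡⇒≡ (toPointwise eq u′⊆u)))) u≈w))
  ...   | no ¬eq = inj₂ (u′ , ℕ.≤∧≢⇒< (length-mono-≤ u′⊆u) ¬eq , u′≈y)

  -- If `x` and `y` differed, using the two hypotheses in turn would shorten a word of `y` forever;
  -- `m` bounds its length.
  ≼-antisym : ∀ {x y} → x ≼ y → y ≼ x → x ≈ y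
  ≼-antisym {x} {y} x≼y y≼x = go (suc (length (word y))) (word y) ℕ.≤-refl (eval-word y)
    where
    go : ∀ m u → length u < m → eval u ≈ y → x ≈ y
    go (suc m) u (s≤s u≤m) u≈y with ≼-subword x≼y u u≈y
    ... | inj₁ x≈y = x≈y
    ... | inj₂ (u′ , u′<u , u′≈x) with ≼-subword y≼x u′ u′≈x
    ...   | inj₁ y≈x = sym y≈x
    ...   | inj₂ (u″ , u″<u′ , u″≈y) = go m u″ (ℕ.<-≤-trans (ℕ.<-trans u″<u′ u′<u) u≤m) u″≈y

  ε≼ : ∀ w → ε ≼ w
  ε≼ w u _ = [] , minimum u , refl

  ≼-inv : ∀ {y w} → y ≼ w → (y ⁻¹) ≼ (w ⁻¹)
  ≼-inv y≼w u u≈w⁻¹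
    with y≼w (reverse u) (trans (eval-reverse u) (trans (⁻¹-cong u≈w⁻¹) (⁻¹-involutive _)))
  ... | u′ , u′⊆ , u′≈y = reverse u′ , ≡.subst (reverse u′ ⊆_) (reverse-involutive u) (reverse⁺ u′⊆)
                        , trans (eval-reverse u′) (⁻¹-cong u′≈y)

  -- Descents and lifting for one-sided multiplication.

  ∙s-descent : ∀ {w i} → inverts w (s i) ≡ true → (w ∙ s i) ≼ w
  ∙s-descent {w} {i} desc u u≈w
    with parity-deletion u (involution i) (≡.trans (parity-eval u (s i) u≈w) desc)
  ... | u′ , u′⊆u , eq = u′ , u′⊆u , trans eq (∙-congʳ u≈w)

  ∙s-ascent : ∀ {w i} → inverts w (s i) ≡ false → w ≼ (w ∙ s i)
  ∙s-ascent {w} {i} asc = ≼-respˡ (cancel-sʳ w i)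
    (∙s-descent (≡.trans (inverts-∙s w i) (≡.cong not asc)))

  -- Appending `i` to `u` gives a word of `w`. Its subword for `y` either avoids the new last letter
  -- or ends in it, and in the latter case dropping that letter leaves a word of `y ∙ s i`.
  subword-∙s : ∀ {y w i} → y ≼ w → ∀ u → eval u ≈ w ∙ s i →
    (∃ λ u′ → u′ ⊆ u × eval u′ ≈ y) ⊎ (∃ λ u′ → u′ ⊆ u × eval u′ ≈ y ∙ s i)
  subword-∙s {y} {w} {i} y≼w u u≈ws
    with y≼w (u ++ [ i ]) (trans (eval-∷ʳ u i) (trans (∙-congʳ u≈ws) (cancel-sʳ w i)))
  ... | v , v⊆ , v≈y with ⊆-∷ʳ⁻ u v⊆
  ...   | inj₁ v⊆u = inj₁ (v , v⊆u , v≈y)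
  ...   | inj₂ (u′ , u′⊆u , ≡.refl) = inj₂ (u′ , u′⊆u ,
            trans (sym (cancel-sʳ _ i)) (∙-congʳ (trans (sym (eval-∷ʳ u′ i)) v≈y)))

  lift-ascentʳ : ∀ {y w i} → inverts y (s i) ≡ false → y ≼ w → y ≼ (w ∙ s i)
  lift-ascentʳ asc y≼w u u≈ws with subword-∙s y≼w u u≈ws
  ... | inj₁ r = r
  ... | inj₂ (u′ , u′⊆u , u′≈ys) with ∙s-ascent asc u′ u′≈ys
  ...   | u″ , u″⊆u′ , u″≈y = u″ , ⊆-trans u″⊆u′ u′⊆u , u″≈y

  lift-descentʳ : ∀ {y w i} → inverts y (s i) ≡ true → y ≼ w → (y ∙ s i) ≼ (w ∙ s i)
  lift-descentʳ desc y≼w u u≈ws with subword-∙s y≼w u u≈ws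
  ... | inj₂ r = r
  ... | inj₁ (u′ , u′⊆u , u′≈y) with ∙s-descent desc u′ u′≈y
  ...   | u″ , u″⊆u′ , u″≈ys = u″ , ⊆-trans u″⊆u′ u′⊆u , u″≈ys

  inv-∙s : ∀ w i → (w ⁻¹ ∙ s i) ⁻¹ ≈ s i ∙ w
  inv-∙s w i = trans (⁻¹-anti-homo-∙ (w ⁻¹) (s i)) (∙-cong (s⁻¹ i) (⁻¹-involutive w))

  -- Left-handed statements follow from the right-handed ones by passing to inverses through
  -- `≼-inv`.
  s∙-descent : ∀ {w i} → inverts (w ⁻¹) (s i) ≡ true → (s i ∙ w) ≼ w
  s∙-descent {w} {i} desc = ≼-respˡ (inv-∙s w i) (≼-respʳ (⁻¹-involutive w) (≼-inv (∙s-descent desc)))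

  lift-ascentˡ : ∀ {y w i} → inverts (y ⁻¹) (s i) ≡ false → y ≼ w → y ≼ (s i ∙ w)
  lift-ascentˡ {y} {w} {i} asc y≼w = ≼-respˡ (⁻¹-involutive y)
    (≼-respʳ (inv-∙s w i) (≼-inv (lift-ascentʳ asc (≼-inv y≼w))))

  lift-descentˡ : ∀ {y w i} → inverts (y ⁻¹) (s i) ≡ true → y ≼ w → (s i ∙ y) ≼ (s i ∙ w)
  lift-descentˡ {y} {w} {i} desc y≼w = ≼-respˡ (inv-∙s y i)
    (≼-respʳ (inv-∙s w i) (≼-inv (lift-descentʳ desc (≼-inv y≼w))))

  -- Multiplying the upper element by the letters of a word of `w ⁻¹` keeps `w` below it, as every
  -- letter is an ascent of `w`. The product ends at `w ∙ w ⁻¹`.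
  only-ε-without-descents : ∀ {w} → (∀ i → inverts w (s i) ≡ false) → w ≈ ε
  only-ε-without-descents {w} asc = ≼-antisym
    (≼-respʳ (inverseʳ w) (≼-respʳ (∙-congˡ (eval-word (w ⁻¹))) (go (word (w ⁻¹)) ≼-refl))) (ε≼ w)
    where
    go : ∀ u {v} → w ≼ v → w ≼ (v ∙ eval u)
    go []      w≼v = ≼-respʳ (sym (identityʳ _)) w≼v
    go (i ∷ u) w≼v = ≼-respʳ (assoc _ _ _) (go u (lift-ascentʳ (asc i) w≼v))

module TwistedInvolutions {c ℓ} (G : Group c ℓ) {n : ℕ} (s : Fin n → Group.Carrier G)
  (coxeter : IsCoxeterSystem G s) (_≟_ : Decidable (Group._≈_ G))
  (θ : Group.Carrier G → Group.Carrier G) (automorphism : IsInvolutiveAutPreservingS G s θ) where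

  open Group G
  open Words G s
  open IsCoxeterSystem coxeter
  open IsInvolutiveAutPreservingS automorphism
  open Twisted G s θ
  open Coxeter G s coxeter _≟_
  open import Algebra.Properties.Group G
  open import Relation.Binary.Reasoning.Setoid setoid

  -- Compatibility of the automorphism with inversions.

  τ : Fin n → Fin n
  τ i = proj₁ (θ-S⊆S i)

  θs≈sτ : ∀ i → θ (s i) ≈ s (τ i)
  θs≈sτ i = proj₂ (θ-S⊆S i)

  θε≈ε : θ ε ≈ ε
  θε≈ε = identityˡ-unique (θ ε) (θ ε) (trans (sym (θ-hom ε ε)) (θ-cong (identityˡ ε)))

  eval-map-τ : ∀ u → eval (map τ u) ≈ θ (eval u)
  eval-map-τ []      = sym θε≈ε
  eval-map-τ (i ∷ u) = trans (∙-cong (sym (θs≈sτ i)) (eval-map-τ u)) (sym (θ-hom (s i) (eval u)))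

  parity-map-τ : ∀ u t → parity (map τ u) (θ t) ≡ parity u t
  parity-map-τ []      t = ≡.refl
  parity-map-τ (i ∷ u) t = ≡.cong₂ _xor_
    (does-≟ (λ e → θ-injective _ _ (trans lhs (trans e (sym rhs))))
            (λ e → trans (sym lhs) (trans (θ-cong e) rhs)))
    (parity-map-τ u t)
    where
    lhs : θ (s i ∙ eval u) ≈ s (τ i) ∙ eval (map τ u)
    lhs = sym (eval-map-τ (i ∷ u))
    rhs : θ (eval u ∙ t) ≈ eval (map τ u) ∙ θ t
    rhs = trans (θ-hom (eval u) t) (∙-congʳ (sym (eval-map-τ u)))

  inverts-θ : ∀ w t → inverts (θ w) (θ t) ≡ inverts w t
  inverts-θ w t = ≡.trans
    (≡.sym (parity-eval (map τ (word w)) (θ t) (trans (eval-map-τ (word w)) (θ-cong (eval-word w)))))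
    (parity-map-τ (word w) t)

  TwInv-resp : ∀ {v w} → v ≈ w → TwInv v → TwInv w
  TwInv-resp v≈w θv = trans (θ-cong (sym v≈w)) (trans θv (⁻¹-cong v≈w))

  θs²≈ε : ∀ i → θ (s i) ∙ θ (s i) ≈ ε
  θs²≈ε i = trans (sym (θ-hom (s i) (s i))) (trans (θ-cong (involution i)) θε≈ε)

  θs⁻¹ : ∀ i → θ (s i) ⁻¹ ≈ θ (s i)
  θs⁻¹ i = sym (inverseʳ-unique (θ (s i)) (θ (s i)) (θs²≈ε i))

  -- The twisted action and its effect on descents.

  conj : Carrier → Fin n → Carrier
  conj w i = θ (s i) ∙ w ∙ s i

  conj-cong : ∀ {v w} i → v ≈ w → conj v i ≈ conj w i
  conj-cong i v≈w = ∙-congʳ (∙-congˡ v≈w)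

  conj-∙s : ∀ w i → conj w i ∙ s i ≈ θ (s i) ∙ w
  conj-∙s w i = cancel-sʳ (θ (s i) ∙ w) i

  conj-involutive : ∀ w i → conj (conj w i) i ≈ w
  conj-involutive w i = begin
    (θ (s i) ∙ ((θ (s i) ∙ w) ∙ s i)) ∙ s i ≈⟨ assoc _ _ _ ⟩
    θ (s i) ∙ (((θ (s i) ∙ w) ∙ s i) ∙ s i) ≈⟨ ∙-congˡ (conj-∙s w i) ⟩
    θ (s i) ∙ (θ (s i) ∙ w)                 ≈⟨ assoc _ _ _ ⟨
    (θ (s i) ∙ θ (s i)) ∙ w                 ≈⟨ ∙-congʳ (θs²≈ε i) ⟩
    ε ∙ w                                   ≈⟨ identityˡ w ⟩
    w                                       ∎

  Act-resp : ∀ {v v′ w w′ i} → v ≈ v′ → w ≈ w′ → Act v i w → Act v′ i w′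
  Act-resp {i = i} v≈v′ w≈w′ (inj₁ (fixed , w≈)) = inj₁
    ( trans (conj-cong i (sym v≈v′)) (trans fixed v≈v′)
    , trans (sym w≈w′) (trans w≈ (∙-congʳ v≈v′)))
  Act-resp {i = i} v≈v′ w≈w′ (inj₂ (¬fixed , w≈)) = inj₂
    ( (λ fixed → ¬fixed (trans (conj-cong i v≈v′) (trans fixed (sym v≈v′))))
    , trans (sym w≈w′) (trans w≈ (conj-cong i v≈v′)))

  Act-functional : ∀ {v w w′ i} → Act v i w → Act v i w′ → w ≈ w′
  Act-functional (inj₁ (_ , p)) (inj₁ (_ , q)) = trans p (sym q)
  Act-functional (inj₂ (_ , p)) (inj₂ (_ , q)) = trans p (sym q)
  Act-functional (inj₁ (f , _)) (inj₂ (¬f , _)) = contradiction f ¬f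
  Act-functional (inj₂ (¬f , _)) (inj₁ (f , _)) = contradiction f ¬f

  act : ∀ w i → ∃ (Act w i)
  act w i with conj w i ≟ w
  ... | yes fixed = w ∙ s i , inj₁ (fixed , refl)
  ... | no ¬fixed = conj w i , inj₂ (¬fixed , refl)

  -- Each branch of the action undoes itself, and the condition that selects the branch has the same
  -- truth value at `v` and at `w`.
  Act-sym : ∀ {v w i} → Act v i w → Act w i v
  Act-sym {v} {w} {i} (inj₁ (fixed , w≈)) = inj₁
    ( trans (conj-cong i w≈) (trans (∙-congʳ (sym (assoc _ _ _))) (trans (∙-congʳ fixed) (sym w≈)))
    , sym (trans (∙-congʳ w≈) (cancel-sʳ v i)))
  Act-sym {v} {w} {i} (inj₂ (¬fixed , w≈)) = inj₂
    ( (λ fixed → ¬fixed (trans (sym w≈) (trans (sym fixed) cw≈v)))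
    , sym cw≈v)
    where
    cw≈v : conj w i ≈ v
    cw≈v = trans (conj-cong i w≈) (conj-involutive v i)

  fixed⇒θs∙w≈w∙s : ∀ {w i} → conj w i ≈ w → θ (s i) ∙ w ≈ w ∙ s i
  fixed⇒θs∙w≈w∙s {w} {i} fixed = trans (sym (conj-∙s w i)) (∙-congʳ fixed)

  TwInv-Act : ∀ {v w i} → Act v i w → TwInv v → TwInv w
  TwInv-Act {v} {w} {i} (inj₁ (fixed , w≈)) θv = begin
    θ w               ≈⟨ θ-cong w≈ ⟩
    θ (v ∙ s i)       ≈⟨ θ-hom v (s i) ⟩
    θ v ∙ θ (s i)     ≈⟨ ∙-cong θv (sym (θs⁻¹ i)) ⟩
    v ⁻¹ ∙ θ (s i) ⁻¹ ≈⟨ ⁻¹-anti-homo-∙ (θ (s i)) v ⟨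
    (θ (s i) ∙ v) ⁻¹  ≈⟨ ⁻¹-cong (trans (fixed⇒θs∙w≈w∙s fixed) (sym w≈)) ⟩
    w ⁻¹              ∎
  TwInv-Act {v} {w} {i} (inj₂ (_ , w≈)) θv = begin
    θ w                              ≈⟨ θ-cong w≈ ⟩
    θ (θ (s i) ∙ v ∙ s i)            ≈⟨ trans (θ-hom _ _) (∙-congʳ (θ-hom _ _)) ⟩
    (θ (θ (s i)) ∙ θ v) ∙ θ (s i)    ≈⟨ ∙-cong (∙-cong θθs≈s⁻¹ θv) (sym (θs⁻¹ i)) ⟩
    (s i ⁻¹ ∙ v ⁻¹) ∙ θ (s i) ⁻¹     ≈⟨ assoc _ _ _ ⟩
    s i ⁻¹ ∙ (v ⁻¹ ∙ θ (s i) ⁻¹)     ≈⟨ ∙-congˡ (⁻¹-anti-homo-∙ (θ (s i)) v) ⟨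
    s i ⁻¹ ∙ (θ (s i) ∙ v) ⁻¹        ≈⟨ ⁻¹-anti-homo-∙ (θ (s i) ∙ v) (s i) ⟨
    (θ (s i) ∙ v ∙ s i) ⁻¹           ≈⟨ ⁻¹-cong w≈ ⟨
    w ⁻¹                             ∎
    where
    θθs≈s⁻¹ : θ (θ (s i)) ≈ s i ⁻¹
    θθs≈s⁻¹ = trans (θ-involutive (s i)) (sym (s⁻¹ i))

  -- Since `w ⁻¹` equals `θ w`, the left descents of a twisted involution are the images under `θ`
  -- of its right descents.
  inverts-TwInv⁻¹ : ∀ {w} → TwInv w → ∀ i → inverts (w ⁻¹) (s (τ i)) ≡ inverts w (s i)
  inverts-TwInv⁻¹ {w} θw i = ≡.trans (inverts-cong (sym θw) (sym (θs≈sτ i))) (inverts-θ w (s i))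

  -- w and w s have the same left descent at θ(s), unless w ↦ θ(s) w s fixes w.
  inverts-∙s⁻¹ : ∀ {w} → TwInv w → ∀ i →
    inverts ((w ∙ s i) ⁻¹) (s (τ i)) ≡ does (conj w i ≟ w) xor inverts w (s i)
  inverts-∙s⁻¹ {w} θw i = ≡.trans
    (≡.sym (parity-eval (i ∷ map τ (word w)) (s (τ i)) eval≈))
    (≡.cong₂ _xor_
      (does-≟ to from)
      (≡.trans (parity-congʳ (map τ (word w)) (sym (θs≈sτ i))) (parity-map-τ (word w) (s i))))
    where
    W = eval (map τ (word w))
    W≈θw : W ≈ θ w
    W≈θw = trans (eval-map-τ (word w)) (θ-cong (eval-word w))
    eval≈ : s i ∙ W ≈ (w ∙ s i) ⁻¹
    eval≈ = begin
      s i ∙ W          ≈⟨ ∙-cong (sym (s⁻¹ i)) (trans W≈θw θw) ⟩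
      s i ⁻¹ ∙ w ⁻¹    ≈⟨ ⁻¹-anti-homo-∙ w (s i) ⟨
      (w ∙ s i) ⁻¹     ∎
    lhs : s i ∙ W ≈ θ (θ (s i) ∙ w)
    lhs = trans (∙-cong (sym (θ-involutive (s i))) W≈θw) (sym (θ-hom _ _))
    rhs : W ∙ s (τ i) ≈ θ (w ∙ s i)
    rhs = trans (∙-cong W≈θw (sym (θs≈sτ i))) (sym (θ-hom _ _))
    to : s i ∙ W ≈ W ∙ s (τ i) → conj w i ≈ w
    to e = trans (∙-congʳ (θ-injective _ _ (trans (sym lhs) (trans e rhs)))) (cancel-sʳ w i)
    from : conj w i ≈ w → s i ∙ W ≈ W ∙ s (τ i)
    from fixed = trans lhs (trans (θ-cong (fixed⇒θs∙w≈w∙s fixed)) (sym rhs))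

  -- Prefixing `τ i` to a word of `w ∙ s i` adds one suffix reflection. It could equal `s i` only if
  -- `conj` fixed `w`, so the parity at `s i` is that of `w ∙ s i`.
  inverts-conj : ∀ {w i} → ¬ (conj w i ≈ w) → inverts (conj w i) (s i) ≡ not (inverts w (s i))
  inverts-conj {w} {i} ¬fixed = ≡.trans
    (≡.sym (parity-eval (τ i ∷ u) (s i)
      (trans (∙-congˡ u≈) (trans (∙-congʳ (sym (θs≈sτ i))) (sym (assoc _ _ _))))))
    (≡.trans test (≡.trans (parity-eval u (s i) u≈) (inverts-∙s w i)))
    where
    u = word (w ∙ s i)
    u≈ : eval u ≈ w ∙ s i
    u≈ = eval-word (w ∙ s i)
    test : parity (τ i ∷ u) (s i) ≡ parity u (s i)
    test with (s (τ i) ∙ eval u) ≟ (eval u ∙ s i)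
    ... | no _  = ≡.refl
    ... | yes e = contradiction (begin
      (θ (s i) ∙ w) ∙ s i  ≈⟨ assoc _ _ _ ⟩
      θ (s i) ∙ (w ∙ s i)  ≈⟨ ∙-cong (θs≈sτ i) (sym u≈) ⟩
      s (τ i) ∙ eval u     ≈⟨ e ⟩
      eval u ∙ s i         ≈⟨ ∙-congʳ u≈ ⟩
      (w ∙ s i) ∙ s i      ≈⟨ cancel-sʳ w i ⟩
      w                    ∎) ¬fixed

  inverts-Act : ∀ {v w i} → Act v i w → inverts w (s i) ≡ not (inverts v (s i))
  inverts-Act {v} {i = i} (inj₁ (_ , w≈))      = ≡.trans (inverts-cong w≈ refl) (inverts-∙s v i)
  inverts-Act             (inj₂ (¬fixed , w≈)) = ≡.trans (inverts-cong w≈ refl) (inverts-conj ¬fixed)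

  Act-irreflexive : ∀ {v w i} → Act v i w → ¬ (v ≈ w)
  Act-irreflexive v→w v≈w = not-¬ (inverts-cong (sym v≈w) refl) (inverts-Act v→w)

  -- Lifting for the twisted action.

  sτ-conj : ∀ w i → s (τ i) ∙ (w ∙ s i) ≈ conj w i
  sτ-conj w i = trans (∙-congʳ (sym (θs≈sτ i))) (sym (assoc _ _ _))

  -- The action multiplies `w` on the right and possibly on the left. Both are ascents of `y`, whose
  -- left and right descents correspond under `θ`.
  lift-ascent : ∀ {y w w′ i} → TwInv y → inverts y (s i) ≡ false → Act w i w′ → y ≼ w → y ≼ w′
  lift-ascent θy asc (inj₁ (_ , w′≈)) y≼w = ≼-respʳ (sym w′≈) (lift-ascentʳ asc y≼w)
  lift-ascent {w = w} {i = i} θy asc (inj₂ (_ , w′≈)) y≼w =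
    ≼-respʳ (trans (sτ-conj w i) (sym w′≈))
      (lift-ascentˡ (≡.trans (inverts-TwInv⁻¹ θy i) asc) (lift-ascentʳ asc y≼w))

  lift-descent : ∀ {y y′ w w′ i} → TwInv y → inverts y (s i) ≡ true →
    Act y i y′ → Act w i w′ → y ≼ w → y′ ≼ w′
  lift-descent {y} {y′} {w} {w′} {i} θy desc y→y′ w→w′ y≼w
    with conj y i ≟ y | inverts-∙s⁻¹ θy i | y→y′ | w→w′
  ... | yes _  | _   | inj₁ (_ , y′≈) | inj₁ (_ , w′≈) =
    ≼-respˡ (sym y′≈) (≼-respʳ (sym w′≈) (lift-descentʳ desc y≼w))
  -- As `conj` fixes `y`, the left descent is used up: `s (τ i)` is a left ascent of `y ∙ s i`, so
  -- the upper element alone can take the left factor.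
  ... | yes _  | eq  | inj₁ (_ , y′≈) | inj₂ (_ , w′≈) =
    ≼-respˡ (sym y′≈) (≼-respʳ (trans (sτ-conj w i) (sym w′≈))
      (lift-ascentˡ (≡.trans eq (≡.cong not desc)) (lift-descentʳ desc y≼w)))
  -- Here `s (τ i)` is still a left descent of `y ∙ s i`, so the lower element alone can take the
  -- left factor.
  ... | no _   | eq  | inj₂ (_ , y′≈) | inj₁ (_ , w′≈) =
    ≼-respˡ (trans (sτ-conj y i) (sym y′≈)) (≼-respʳ (sym w′≈)
      (≼-trans (s∙-descent (≡.trans eq desc)) (lift-descentʳ desc y≼w)))
  ... | no _   | eq  | inj₂ (_ , y′≈) | inj₂ (_ , w′≈) =
    ≼-respˡ (trans (sτ-conj y i) (sym y′≈)) (≼-respʳ (trans (sτ-conj w i) (sym w′≈))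
      (lift-descentˡ (≡.trans eq desc) (lift-descentʳ desc y≼w)))
  ... | yes f  | _   | inj₂ (¬f , _) | _ = contradiction f ¬f
  ... | no ¬f  | _   | inj₁ (f , _)  | _ = contradiction f ¬f

  Act-descent : ∀ {v w i} → TwInv w → inverts w (s i) ≡ true → Act w i v → v ≼ w
  Act-descent θw desc w→v = lift-ascent (TwInv-Act w→v θw)
    (≡.trans (inverts-Act w→v) (≡.cong not desc)) (Act-sym w→v) ≼-refl

  -- Twisted words and the rank.

  data Reach : ℕ → Carrier → Set (c ⊔ ℓ) where
    origin : ∀ {w} → ε ≈ w → Reach zero w
    step  : ∀ {k v w i} → Reach k v → Act v i w → Reach (suc k) w

  -- `Reach` grows twisted words at the right end, so induction removes the last letter `i`. If `i`
  -- is an ascent of `y`, it is dropped; if a descent, it is kept and acts on both elements. When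
  -- every letter is kept the elements coincide, which gives strictness.
  exchange : ∀ {k y w} → Reach k w → TwInv y → y ≼ w →
    ∃ λ k′ → Reach k′ y × k′ ≤ k × (¬ (y ≈ w) → k′ < k)
  exchange {y = y} (origin ε≈w) θy y≼w = zero , origin (sym y≈ε) , z≤n
                                      , λ y≉w → contradiction (trans y≈ε ε≈w) y≉w
    where
    y≈ε : y ≈ ε
    y≈ε = ≼-antisym (≼-respʳ (sym ε≈w) y≼w) (ε≼ y)
  exchange {y = y} (step {i = i} r v→w) θy y≼w with inverts y (s i) in eq
  ... | false with exchange r θy (lift-ascent θy eq (Act-sym v→w) y≼w)
  ...   | k′ , r′ , k′≤k , _ = k′ , r′ , ℕ.m≤n⇒m≤1+n k′≤k , λ _ → s≤s k′≤k
  exchange {y = y} (step {i = i} r v→w) θy y≼w | true with act y i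
  ... | y′ , y→y′ with exchange r (TwInv-Act y→y′ θy) (lift-descent θy eq y→y′ (Act-sym v→w) y≼w)
  ...   | k′ , r′ , k′≤k , strict = suc k′ , step r′ (Act-sym y→y′) , s≤s k′≤k
          , λ y≉w → s≤s (strict λ y′≈v → y≉w (Act-functional (Act-resp y′≈v refl (Act-sym y→y′)) v→w))

  HasRank : Carrier → ℕ → Set (c ⊔ ℓ)
  HasRank w k = Reach k w × (∀ k′ → Reach k′ w → k ≤ k′)

  HasRank-unique : ∀ {w k k′} → HasRank w k → HasRank w k′ → k ≡ k′
  HasRank-unique (r , min) (r′ , min′) = ℕ.≤-antisym (min _ r′) (min′ _ r)

  -- `exchange` turns each twisted word of `w` into a strictly shorter one of `v`, while one step
  -- from `v` reaches `w`.
  HasRank-descent : ∀ {v w i k} → TwInv w → inverts w (s i) ≡ true → Act w i v →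
    HasRank v k → HasRank w (suc k)
  HasRank-descent {v} {w} {k = k} θw desc w→v (r , min) = step r (Act-sym w→v) , min′
    where
    min′ : ∀ k′ → Reach k′ w → suc k ≤ k′
    min′ k′ r′ with exchange r′ (TwInv-Act w→v θw) (Act-descent θw desc w→v)
    ... | k″ , r″ , _ , strict = ℕ.≤-<-trans (min k″ r″) (strict λ v≈w → Act-irreflexive w→v (sym v≈w))

  HasRank-ε : ∀ {w} → w ≈ ε → HasRank w zero
  HasRank-ε w≈ε = origin (sym w≈ε) , λ _ _ → z≤n

  -- Descents are followed until none is left, that is, down to `ε`. Termination is measured by
  -- ordinary words, which shorten at each descent by `≼-subword`.
  rank : ∀ {w} → TwInv w → ∃ (HasRank w)
  rank {w} θw = go (suc (length (word w))) (word w) ℕ.≤-refl (eval-word w) θw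
    where
    go : ∀ m u {w} → length u < m → eval u ≈ w → TwInv w → ∃ (HasRank w)
    go (suc m) u {w} (s≤s u≤m) u≈w θw with any? (λ i → inverts w (s i) Bool.≟ true)
    ... | no ¬desc = zero , HasRank-ε (only-ε-without-descents λ i → ¬-not λ e → ¬desc (i , e))
    ... | yes (i , desc) with act w i
    ...   | v , w→v with ≼-subword (Act-descent θw desc w→v) u u≈w
    ...     | inj₁ v≈w = contradiction (sym v≈w) (Act-irreflexive w→v)
    ...     | inj₂ (u′ , u′<u , u′≈v) with go m u′ (ℕ.<-≤-trans u′<u u≤m) u′≈v (TwInv-Act w→v θw)
    ...       | k , rk = suc k , HasRank-descent θw desc w→v rk

  -- Comparison with `Run` and `Rank`; the weak order.

  run-resp : ∀ {v v′ w w′ l} → v ≈ v′ → w ≈ w′ → Run v l w → Run v′ l w′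
  run-resp v≈v′ w≈w′ (run-[] v≈w)  = run-[] (trans (sym v≈v′) (trans v≈w w≈w′))
  run-resp v≈v′ w≈w′ (run-∷ v→u r) = run-∷ (Act-resp v≈v′ refl v→u) (run-resp refl w≈w′ r)

  run-∷ʳ : ∀ {v w x l i} → Run v l w → Act w i x → Run v (l ++ [ i ]) x
  run-∷ʳ (run-[] v≈w)  w→x = run-∷ (Act-resp (sym v≈w) refl w→x) (run-[] refl)
  run-∷ʳ (run-∷ v→u r) w→x = run-∷ v→u (run-∷ʳ r w→x)

  Reach-resp : ∀ {k v w} → v ≈ w → Reach k v → Reach k w
  Reach-resp v≈w (origin ε≈v) = origin (trans ε≈v v≈w)
  Reach-resp v≈w (step r u→v) = step r (Act-resp refl v≈w u→v)

  run⇒Reach : ∀ {k v l w} → Reach k v → Run v l w → Reach (length l + k) w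
  run⇒Reach r (run-[] v≈w) = Reach-resp v≈w r
  run⇒Reach {k} {l = _ ∷ l} {w} r (run-∷ v→u r′) =
    ≡.subst (λ m → Reach m w) (ℕ.+-suc (length l) k) (run⇒Reach (step r v→u) r′)

  Reach⇒run : ∀ {k w} → Reach k w → ∃ λ l → length l ≡ k × Run ε l w
  Reach⇒run (origin ε≈w) = [] , ≡.refl , run-[] ε≈w
  Reach⇒run (step {i = i} r v→w) with Reach⇒run r
  ... | l , ≡.refl , run = l ++ [ i ] , length-∷ʳ l i , run-∷ʳ run v→w

  run-ε⇒Reach : ∀ {l w} → Run ε l w → Reach (length l) w
  run-ε⇒Reach {l} {w} run =
    ≡.subst (λ m → Reach m w) (ℕ.+-identityʳ (length l)) (run⇒Reach (origin refl) run)

  HasRank⇒Rank : ∀ {w k} → HasRank w k → Rank w k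
  HasRank⇒Rank (r , min) = Reach⇒run r , λ l run → min (length l) (run-ε⇒Reach run)

  Rank⇒HasRank : ∀ {w k} → Rank w k → HasRank w k
  Rank⇒HasRank {w} ((l , ≡.refl , run) , min) = run-ε⇒Reach run , min′
    where
    min′ : ∀ k′ → Reach k′ w → length l ≤ k′
    min′ k′ r with Reach⇒run r
    ... | l′ , ≡.refl , run′ = min l′ run′

  HasRank-resp : ∀ {v w k} → v ≈ w → HasRank v k → HasRank w k
  HasRank-resp v≈w (r , min) = Reach-resp v≈w r , λ k′ r′ → min k′ (Reach-resp (sym v≈w) r′)

  ⪯-resp : ∀ {v v′ w w′} → v ≈ v′ → w ≈ w′ → v ⪯ w → v′ ⪯ w′
  ⪯-resp v≈v′ w≈w′ (l , run , kv , kw , rv , rw , eq) =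
    l , run-resp v≈v′ w≈w′ run , kv , kw
    , HasRank⇒Rank (HasRank-resp v≈v′ (Rank⇒HasRank rv))
    , HasRank⇒Rank (HasRank-resp w≈w′ (Rank⇒HasRank rw)) , eq

  descent-⪯ : ∀ {v w i} → TwInv w → inverts w (s i) ≡ true → Act w i v → v ⪯ w
  descent-⪯ {i = i} θw desc w→v with rank (TwInv-Act w→v θw)
  ... | k , rk = [ i ] , run-∷ (Act-sym w→v) (run-[] refl) , k , suc k
               , HasRank⇒Rank rk , HasRank⇒Rank (HasRank-descent θw desc w→v rk) , ℕ.+-comm k 1

  -- Connected components and their weak-order minima.

  Conn-trans : ∀ {J x y z} → Conn J x y → Conn J y z → Conn J x z
  Conn-trans (here x≈y) (here y≈z)                  = here (trans x≈y y≈z)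
  Conn-trans (here x≈y) (fwd i∈J (θy , θu , y→u) p) =
    fwd i∈J (TwInv-resp (sym x≈y) θy , θu , Act-resp (sym x≈y) refl y→u) p
  Conn-trans (here x≈y) (bwd i∈J (θu , θy , u→y) p) =
    bwd i∈J (θu , TwInv-resp (sym x≈y) θy , Act-resp refl (sym x≈y) u→y) p
  Conn-trans (fwd i∈J e p) q = fwd i∈J e (Conn-trans p q)
  Conn-trans (bwd i∈J e p) q = bwd i∈J e (Conn-trans p q)

  Conn-sym : ∀ {J x y} → Conn J x y → Conn J y x
  Conn-sym (here x≈y)    = here (sym x≈y)
  Conn-sym (fwd i∈J e p) = Conn-trans (Conn-sym p) (bwd i∈J e (here refl))
  Conn-sym (bwd i∈J e p) = Conn-trans (Conn-sym p) (fwd i∈J e (here refl))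

  Conn-mono : ∀ {I J x y} → (∀ {i} → i ∈ I → i ∈ J) → Conn I x y → Conn J x y
  Conn-mono I⊆J (here x≈y)    = here x≈y
  Conn-mono I⊆J (fwd i∈I e p) = fwd (I⊆J i∈I) e (Conn-mono I⊆J p)
  Conn-mono I⊆J (bwd i∈I e p) = bwd (I⊆J i∈I) e (Conn-mono I⊆J p)

  Conn-∅ : ∀ {x y} → Conn ∅ x y → x ≈ y
  Conn-∅ (here x≈y)    = x≈y
  Conn-∅ (fwd i∈∅ _ _) = contradiction i∈∅ ∉⊥
  Conn-∅ (bwd i∈∅ _ _) = contradiction i∈∅ ∉⊥

  HasDescentIn : Subset n → Carrier → Set
  HasDescentIn J w = ∃ λ i → i ∈ J × inverts w (s i) ≡ true

  hasDescentIn? : ∀ J w → Dec (HasDescentIn J w)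
  hasDescentIn? J w = any? λ i → (i ∈? J) ×-dec (inverts w (s i) Bool.≟ true)

  -- An edge in either direction is one action by a letter of `J`, an ascent of `x`, so
  -- `lift-ascent` carries `x ≼ y` along the path.
  descentless-≼ : ∀ {J x y z} → TwInv x → ¬ HasDescentIn J x → Conn J y z → x ≼ y → x ≼ z
  descentless-≼ θx ¬desc (here y≈z) x≼y = ≼-respʳ y≈z x≼y
  descentless-≼ θx ¬desc (fwd {i = i} i∈J (_ , _ , y→u) p) x≼y = descentless-≼ θx ¬desc p
    (lift-ascent θx (¬-not λ e → ¬desc (i , i∈J , e)) y→u x≼y)
  descentless-≼ θx ¬desc (bwd {i = i} i∈J (_ , _ , u→y) p) x≼y = descentless-≼ θx ¬desc p
    (lift-ascent θx (¬-not λ e → ¬desc (i , i∈J , e)) (Act-sym u→y) x≼y)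

  descentless-unique : ∀ {J x y} → TwInv x → TwInv y →
    ¬ HasDescentIn J x → ¬ HasDescentIn J y → Conn J x y → x ≈ y
  descentless-unique θx θy ¬dx ¬dy p = ≼-antisym
    (descentless-≼ θx ¬dx p ≼-refl) (descentless-≼ θy ¬dy (Conn-sym p) ≼-refl)

  -- Following descents in `J` from `y` stays in the component and can stop only at `x`. Each step
  -- lowers the rank by one, so the reversed path has the length that `_⪯_` demands.
  descentless-minimum : ∀ {J x y} → TwInv x → TwInv y → ¬ HasDescentIn J x → Conn J x y → x ⪯ y
  descentless-minimum {J} {x} θx θy ¬dx p with rank θx
  ... | kx , rx with go _ θy (proj₂ (rank θy)) p
    where
    go : ∀ k {y} → TwInv y → HasRank y k → Conn J x y → ∃ λ l → Run x l y × kx + length l ≡ k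
    go k {y} θy ry p with hasDescentIn? J y
    ... | no ¬dy = [] , run-[] x≈y , ≡.trans (ℕ.+-identityʳ kx) (HasRank-unique (HasRank-resp x≈y rx) ry)
      where x≈y = descentless-unique θx θy ¬dx ¬dy p
    ... | yes (i , i∈J , desc) with act y i
    ...   | v , y→v with rank (TwInv-Act y→v θy)
    -- Uniqueness of the rank makes `k` the successor of `k′`, so the recursion is structural.
    ...     | k′ , rv with HasRank-unique ry (HasRank-descent θy desc y→v rv)
    ...       | ≡.refl with go k′ (TwInv-Act y→v θy) rv
                              (Conn-trans p (fwd i∈J (θy , TwInv-Act y→v θy , y→v) (here refl)))
    ...         | l , run , eq = l ++ [ i ] , run-∷ʳ run (Act-sym y→v)
                  , ≡.trans (≡.cong (kx +_) (length-∷ʳ l i))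
                      (≡.trans (ℕ.+-suc kx (length l)) (≡.cong suc eq))
  ...   | l , run , eq = l , run , kx , _ , HasRank⇒Rank rx , HasRank⇒Rank (proj₂ (rank θy)) , eq

  -- Faces of the complex and the shelling property.

  facet-⊑ : ∀ {J w x} → Conn J w x → (w , J) ⊑ facet x
  facet-⊑ p = (λ v q → Conn-trans p (here (Conn-∅ q))) , λ _ _ _ e → contradiction (proj₁ e) ∉⊥

  ⊑-facet⇒Conn : ∀ {J w x} → (w , J) ⊑ facet x → Conn J w x
  ⊑-facet⇒Conn {x = x} (vertices , _) = vertices x (here refl)

  ⊑-coatom : ∀ {J w x j} → j ∈ J → Conn J w x → (w , J) ⊑ (x , ⁅ j ⁆)
  ⊑-coatom {J} {w} {x} {j} j∈J p =
    (λ _ → widen) , λ { _ _ _ (i∈ , q , r , e) → ⁅j⁆⊆J i∈ , widen q , widen r , e }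
    where
    ⁅j⁆⊆J : ∀ {i} → i ∈ ⁅ j ⁆ → i ∈ J
    ⁅j⁆⊆J i∈ = ≡.subst (_∈ J) (≡.sym (x∈⁅y⁆⇒x≡y j i∈)) j∈J
    widen : ∀ {v} → Conn ⁅ j ⁆ x v → Conn J w v
    widen q = Conn-trans p (Conn-mono ⁅j⁆⊆J q)

  -- The action is total, so `w` carries an edge of every label; the edges at `w` therefore detect
  -- all of `J`.
  ⊑⇒⊇ : ∀ {I J v w} → TwInv w → (v , I) ⊑ (w , J) → ∀ {i} → i ∈ J → i ∈ I
  ⊑⇒⊇ {w = w} θw (_ , edges) {i} i∈J with act w i
  ... | u , w→u = proj₁ (edges w i u (i∈J , here refl , fwd i∈J e (here refl) , e))
    where e = θw , TwInv-Act w→u θw , w→u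

  dim-coatom : ∀ {J w x j} → J ≡ ⁅ j ⁆ → dim (w , J) ≡ dim (facet x) ℤ.- ℤ.+ 1
  dim-coatom {j = j} ≡.refl rewrite ∣⁅x⁆∣≡1 j | ∣⊥∣≡0 n =
    ≡.cong (λ m → (m ℤ.- ℤ.+ 1) ℤ.- ℤ.+ 1) (≡.sym (ℤ.+-identityʳ (ℤ.+ n)))

  module _ {N : ℕ} (ord : Fin N → Carrier) where

    linear-extension-pure : IsLinearExtension N ord → ∀ a → PureCodim1 ord a
    linear-extension-pure ((θord , covers , inj) , monotone) a (w , J)
      ((θw , g⊑a , b , b<a , g⊑b) , maximal)
      with hasDescentIn? J (ord a)
    -- Without a descent in `J`, `ord a` would be the minimum of a component containing the earlier
    -- `ord b`.
    ... | no ¬desc = contradiction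
      (monotone a b (descentless-minimum (θord a) (θord b) ¬desc
        (Conn-trans (Conn-sym (⊑-facet⇒Conn g⊑a)) (⊑-facet⇒Conn g⊑b))))
      (ℕ.<⇒≱ b<a)
    ... | yes (j , j∈J , desc) with act (ord a) j
    ...   | v , a→v with covers v (TwInv-Act a→v (θord a))
    ...     | d , d≈v = dim-coatom {w = w} {x = ord a} {j = j} (⊆-antisym J⊆⁅j⁆ ⁅j⁆⊆J)
      where
      h = ord a , ⁅ j ⁆
      θv = TwInv-Act a→v (θord a)
      d≤a : d Fin.≤ a
      d≤a = monotone d a (⪯-resp (sym d≈v) refl (descent-⪯ (θord a) desc a→v))
      d≢a : ¬ d ≡ a
      d≢a ≡.refl = Act-irreflexive a→v d≈v
      a–d : Conn ⁅ j ⁆ (ord a) (ord d)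
      a–d = fwd (x∈⁅x⁆ j) (θord a , θv , a→v) (here (sym d≈v))
      h∈ : InIntersection ord a h
      h∈ = θord a , facet-⊑ (here refl) , d , ≤∧≢⇒< d≤a d≢a , facet-⊑ a–d
      h⊑g : h ⊑ (w , J)
      -- The face `h` contains the given cell and lies in the intersection, so maximality makes them
      -- equal and `J` is the singleton of `j`.
      h⊑g = maximal h h∈ (⊑-coatom j∈J (⊑-facet⇒Conn g⊑a))
      J⊆⁅j⁆ : ∀ {i} → i ∈ J → i ∈ ⁅ j ⁆
      J⊆⁅j⁆ = ⊑⇒⊇ θw h⊑g
      ⁅j⁆⊆J : ∀ {i} → i ∈ ⁅ j ⁆ → i ∈ J
      ⁅j⁆⊆J i∈ = ≡.subst (_∈ J) (≡.sym (x∈⁅y⁆⇒x≡y j i∈)) j∈J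

    linear-extension-shelling : IsLinearExtension N ord → IsShellingOrder N ord
    linear-extension-shelling ext@(ordering , _) = ordering , λ a _ → linear-extension-pure ext a

  -- Existence of a linear extension.

  ⪯∧rank-≥⇒≈ : ∀ {v w k m} → HasRank v k → HasRank w m → v ⪯ w → m ≤ k → v ≈ w
  ⪯∧rank-≥⇒≈ _ _ ([] , run-[] v≈w , _) _ = v≈w
  -- A nonempty run in the weak order raises the rank strictly, against `m ≤ k`.
  ⪯∧rank-≥⇒≈ {k = k} rv rw (_ ∷ _ , _ , _ , _ , rv′ , rw′ , eq) m≤k
    with HasRank-unique (Rank⇒HasRank rv′) rv | HasRank-unique (Rank⇒HasRank rw′) rw
  ... | ≡.refl | ≡.refl = contradiction m≤k (ℕ.<⇒≱ (≡.subst (k <_) eq (ℕ.m<m+n k (s≤s z≤n))))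

  -- Twisted involutions are sorted by rank. Ties may fall in any order, since distinct elements of
  -- equal rank are incomparable.
  linear-extension : IsFinite G → ∃ λ N → ∃ λ ord → IsLinearExtension N ord
  linear-extension (k , e , surj , inj) = length xs , ord , (θord , covers , ord-inj) , monotone
    where
    TwInv? : ∀ w → Dec (TwInv w)
    TwInv? w = θ w ≟ (w ⁻¹)

    key : Fin k → ℕ
    key a with TwInv? (e a)
    ... | yes θa = proj₁ (rank θa)
    -- A dummy value: elements that are not twisted involutions are filtered out before sorting.
    ... | no _   = 0

    HasRank-key : ∀ {a} → TwInv (e a) → HasRank (e a) (key a)
    HasRank-key {a} θa with TwInv? (e a)
    ... | yes θa′ = proj₂ (rank θa′)
    ... | no ¬θa  = contradiction θa ¬θa

    order = On.decTotalOrder ℕ.≤-decTotalOrder key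
    open Sort order using (sort; sort-↭; sort-↗)

    ys = filter (TwInv? ∘ e) (allFin k)
    xs = sort ys

    ord : Fin (length xs) → Carrier
    ord a = e (lookup xs a)

    θord : ∀ a → TwInv (ord a)
    θord a = proj₂ (∈-filter⁻ (TwInv? ∘ e) {xs = allFin k} (∈-resp-↭ (sort-↭ ys) (∈-lookup {xs = xs} a)))

    covers : ∀ w → TwInv w → ∃ λ a → ord a ≈ w
    covers w θw with surj w
    ... | b , eb≈w = index b∈xs , trans (reflexive (≡.cong e (≡.sym (lookup-index b∈xs)))) eb≈w
      where
      b∈xs = ∈-resp-↭ (↭-sym (sort-↭ ys))
        (∈-filter⁺ (TwInv? ∘ e) (∈-allFin b) (TwInv-resp (sym eb≈w) θw))

    xs-unique : Unique xs
    xs-unique = Unique-resp-↭ (≡.setoid _) (↭⇒↭ₛ (↭-sym (sort-↭ ys)))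
      (filter⁺ (TwInv? ∘ e) (allFin⁺ k))

    ord-inj : ∀ a b → ord a ≈ ord b → a ≡ b
    ord-inj a b a≈b = lookup-injective xs-unique a b (inj _ _ a≈b)

    monotone : ∀ a b → ord a ⪯ ord b → a Fin.≤ b
    monotone a b a⪯b with a Fin.≤? b
    ... | yes a≤b = a≤b
    ... | no a≰b = contradiction
      (ord-inj a b (⪯∧rank-≥⇒≈ (HasRank-key (θord a)) (HasRank-key (θord b)) a⪯b b≤a))
      λ { ≡.refl → a≰b ℕ.≤-refl }
      where
      b≤a = lookup-mono-≤ (DecTotalOrder.totalOrder order) (sort-↗ ys) (ℕ.<⇒≤ (ℕ.≰⇒> a≰b))

-- The enumeration is injective, so equality in the group reduces to equality of indices. This
-- supplies the tests behind `parity` and the case split in `act`.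
finite⇒decidable : ∀ {c ℓ} (G : Group c ℓ) → IsFinite G → Decidable (Group._≈_ G)
finite⇒decidable G (_ , e , surj , inj) v w with surj v | surj w
... | a , ea≈v | b , eb≈w with a Fin.≟ b
...   | yes ≡.refl = yes (trans (sym ea≈v) eb≈w)
  where open Group G
...   | no a≢b = no λ v≈w → a≢b (inj a b (trans ea≈v (trans v≈w (sym eb≈w))))
  where open Group G

theorem5p7 : ∀ {c ℓ} (G : Group c ℓ) (n : ℕ) (s : Fin n → Group.Carrier G) →
    IsCoxeterSystem G s → IsFinite G →
    (θ : Group.Carrier G → Group.Carrier G) → IsInvolutiveAutPreservingS G s θ →
    let open Twisted G s θ in
    ((N : ℕ) (ord : Fin N → Group.Carrier G) →
    IsLinearExtension N ord → IsShellingOrder N ord)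
    × Shellable
theorem5p7 G n s coxeter finite θ automorphism = (λ _ → linear-extension-shelling) , shellable
  where
  open Twisted G s θ
  open TwistedInvolutions G s coxeter (finite⇒decidable G finite) θ automorphism
  shellable : Shellable
  shellable with linear-extension finite
  ... | N , ord , ext = N , ord , linear-extension-shelling ord ext
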